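{- For all integers $r\ge 0$, $$f(r+4)\le 8\cdot 2^r+9f(r).$$ Hence, writing $g(d)=f(d)/2^d$, one has $g(r+4)\le \tfrac12+\tfrac{9}{16}g(r)$ for all $r\ge 0$, where the map $t\mapsto\tfrac12+\tfrac9{16}t$ has fixed point $\tfrac87$, so that $f(d)\le(\tfrac87+o(1))2^d$ as $d\to\infty$; for example $f(9)\le 625$.
   Context: Write $[3]=\{0,1,2\}$. A proper sub-box of $[3]^d$ is a set $B=S_1\times\dots\times S_d$ with $\varnothing\neq S_i\subsetneq[3]$ for every $1\le i\le d$ (so each side $S_i$ has one or two elements). A double cover of $[3]^d$ is a finite multiset $\{B_1,\dots,B_m\}$ of proper sub-boxes such that every point of $[3]^d$ lies in exactly two of the $B_j$, counted with multiplicity; its size is $m$. $f(d)$ denotes the minimum size of a double cover of $[3]^d$. For $d=0$, $[3]^0$ is a single point, which is itself the only proper sub-box. It is known from earlier work that $[3]^5$ has a double cover with $41$ boxes, i.e. $f(5)\le 41$. -}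

module Defs where

open import Data.Fin.Base using (Fin)
open import Data.Fin.Patterns using (0F)
open import Data.Fin.Properties using (any?)
open import Data.Fin.Subset using (Subset; Nonempty; _∈_; _⊂_; ⊤; ⁅_⁆; ∁)
open import Data.Fin.Subset.Properties using (_∈?_; _⊂?_; nonempty?; anySubset?; x∈p⇒x∉∁p; x∉p⇒x∈∁p)
open import Data.Integer.Base using (+_)
open import Data.List.Base using (List; []; _∷_; _++_; map; filter; length)
open import Data.List.Properties using (filter-++; length-++)
open import Data.List.Relation.Unary.All as All using (All; []; _∷_)
import Data.List.Relation.Unary.All.Properties as Allₚ
open import Data.Nat.Base using (ℕ; zero; suc; _+_; _^_; _≤_; _<_)
open import Data.Nat.Induction using (<-rec)
open import Data.Nat.Properties using (_≟_; m^n≢0; anyUpTo?; ≮⇒≥; +-identityʳ)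
open import Data.Product.Base using (∃; _×_; _,_; proj₁)
open import Data.Rational.Base as ℚ using (ℚ; 0ℚ; ½; ∣_∣)
open import Data.Vec.Base using (Vec; []; _∷_)
open import Data.Vec.Relation.Binary.Pointwise.Inductive as Pointwise using (Pointwise; []; _∷_)
import Data.Vec.Relation.Unary.All as VAll
open import Function.Base using (_∘_)
open import Relation.Binary.PropositionalEquality
  using (_≡_; refl; trans; cong; cong₂)
open import Relation.Nullary.Decidable using (Dec; yes; no; map′; _×-dec_; ¬?; decidable-stable; from-yes)
open import Relation.Nullary.Negation using (¬_; contradiction)
open import Level using (0ℓ)
open import Relation.Unary using (Pred; Decidable)

-- Points of [3]^d.
Point : ℕ → Set
Point d = Vec (Fin 3) d

-- The product S₁ × … × S_d is represented by its list of sides.  When all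
-- sides are nonempty, the sides are determined by the product set.
Box : ℕ → Set
Box d = Vec (Subset 3) d

ProperSide : Subset 3 → Set
ProperSide S = Nonempty S × S ⊂ ⊤

Proper : ∀ {d} → Box d → Set
Proper = VAll.All ProperSide

infix 4 _∈ᴮ_ _∈ᴮ?_

_∈ᴮ_ : ∀ {d} → Point d → Box d → Set
_∈ᴮ_ = Pointwise _∈_

_∈ᴮ?_ : ∀ {d} (p : Point d) (B : Box d) → Dec (p ∈ᴮ B)
_∈ᴮ?_ = Pointwise.decidable _∈?_

multiplicity : ∀ {d} → Point d → List (Box d) → ℕ
multiplicity p Bs = length (filter (p ∈ᴮ?_) Bs)

-- A finite multiset of boxes is given by a list; neither the conditions below
-- nor the size depend on the order of the list.
DoubleCover : ∀ {d} → List (Box d) → Set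
DoubleCover Bs = All Proper Bs × (∀ p → multiplicity p Bs ≡ 2)

HasDoubleCover : ℕ → ℕ → Set
HasDoubleCover d m = ∃ λ (Bs : List (Box d)) → DoubleCover Bs × length Bs ≡ m

IsMinimumSize : ℕ → ℕ → Set
IsMinimumSize d m = HasDoubleCover d m × (∀ k → HasDoubleCover d k → m ≤ k)

-- The minimum exists because some double cover exists and because it is
-- decidable whether there is one of a given size.
private
  Searchable : Set → Set₁
  Searchable A = ∀ {P : Pred A 0ℓ} → Decidable P → Dec (∃ P)

  search-Vec : ∀ {A} → Searchable A → ∀ n → Searchable (Vec A n)
  search-Vec s zero    P? = map′ ([] ,_) (λ { ([] , p) → p }) (P? [])
  search-Vec s (suc n) P? =
    map′ (λ { (x , xs , p) → x ∷ xs , p }) (λ { (x ∷ xs , p) → x , xs , p })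
         (s λ x → search-Vec s n λ xs → P? (x ∷ xs))

  all-from-search : ∀ {A} → Searchable A →
                    ∀ {P : Pred A 0ℓ} → Decidable P → Dec (∀ x → P x)
  all-from-search s P? with s (¬? ∘ P?)
  ... | yes (x , ¬p) = no λ all → ¬p (all x)
  ... | no  none     = yes λ x → decidable-stable (P? x) λ ¬p → none (x , ¬p)

  side? : Decidable ProperSide
  side? S = nonempty? S ×-dec (S ⊂? ⊤)

  proper? : ∀ {d} → Decidable (Proper {d})
  proper? = VAll.all? side?

  doubleCover? : ∀ {d} → Decidable (DoubleCover {d})
  doubleCover? {d} Bs =
    All.all? proper? Bs ×-dec
    all-from-search (search-Vec any? d) (λ p → multiplicity p Bs ≟ 2)

  search-List : ∀ {A} → Searchable A → ∀ m {P : Pred (List A) 0ℓ} → Decidable P →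
                Dec (∃ λ xs → P xs × length xs ≡ m)
  search-List s zero    P? =
    map′ (λ p → [] , p , refl) (λ { ([] , p , _) → p }) (P? [])
  search-List s (suc m) P? =
    map′ (λ { (x , xs , p , e) → x ∷ xs , p , cong suc e })
         (λ { (x ∷ xs , p , refl) → x , xs , p , refl })
         (s λ x → search-List s m λ xs → P? (x ∷ xs))

  hasDoubleCover? : ∀ d → Decidable (HasDoubleCover d)
  hasDoubleCover? d m = search-List (search-Vec anySubset? d) m doubleCover?

  least : ∀ {P : Pred ℕ 0ℓ} → Decidable P → ∀ n → P n →
          ∃ λ m → P m × (∀ k → P k → m ≤ k)
  least {P} P? = <-rec (λ n → P n → ∃ λ m → P m × (∀ k → P k → m ≤ k)) step
    where
    step : ∀ n → (∀ {i} → i < n → P i → ∃ λ m → P m × (∀ k → P k → m ≤ k)) →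
           P n → ∃ λ m → P m × (∀ k → P k → m ≤ k)
    step n rec pn with anyUpTo? P? n
    ... | yes (i , i<n , pi) = rec i<n pi
    ... | no  none           = n , pn , λ k pk → ≮⇒≥ λ k<n → none (k , k<n , pk)

  extend : ∀ {d} → Subset 3 → List (Box d) → List (Box (suc d))
  extend S = map (S ∷_)

  multiplicity-in : ∀ {d} {x S} → x ∈ S → (p : Point d) (Bs : List (Box d)) →
                    multiplicity (x ∷ p) (extend S Bs) ≡ multiplicity p Bs
  multiplicity-in x∈S p [] = refl
  multiplicity-in {x = x} {S} x∈S p (B ∷ Bs) with x ∈? S | p ∈ᴮ? B
  ... | yes _   | yes _ = cong suc (multiplicity-in x∈S p Bs)
  ... | yes _   | no  _ = multiplicity-in x∈S p Bs
  ... | no  x∉S | _     = contradiction x∈S x∉S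

  multiplicity-out : ∀ {d} {x S} → ¬ x ∈ S → (p : Point d) (Bs : List (Box d)) →
                     multiplicity (x ∷ p) (extend S Bs) ≡ 0
  multiplicity-out x∉S p [] = refl
  multiplicity-out {x = x} {S} x∉S p (B ∷ Bs) with x ∈? S
  ... | yes x∈S = contradiction x∈S x∉S
  ... | no  _   = multiplicity-out x∉S p Bs

  multiplicity-++ : ∀ {d} (p : Point d) Bs Cs →
                    multiplicity p (Bs ++ Cs) ≡ multiplicity p Bs + multiplicity p Cs
  multiplicity-++ p Bs Cs =
    trans (cong length (filter-++ (p ∈ᴮ?_) Bs Cs)) (length-++ (filter (p ∈ᴮ?_) Bs))

  slices : ∀ {d} → List (Box d) → List (Box (suc d))
  slices Bs = extend ⁅ 0F ⁆ Bs ++ extend (∁ ⁅ 0F ⁆) Bs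

  slices-proper : ∀ {d} {Bs : List (Box d)} → All Proper Bs → All Proper (slices Bs)
  slices-proper proper = Allₚ.++⁺
    (Allₚ.map⁺ (All.map (from-yes (side? ⁅ 0F ⁆) VAll.∷_) proper))
    (Allₚ.map⁺ (All.map (from-yes (side? (∁ ⁅ 0F ⁆)) VAll.∷_) proper))

  slices-multiplicity : ∀ {d} x (p : Point d) Bs →
                        multiplicity (x ∷ p) (slices Bs) ≡ multiplicity p Bs
  slices-multiplicity x p Bs =
    trans (multiplicity-++ (x ∷ p) (extend ⁅ 0F ⁆ Bs) (extend (∁ ⁅ 0F ⁆) Bs)) by-slice
    where
    by-slice : multiplicity (x ∷ p) (extend ⁅ 0F ⁆ Bs) +
               multiplicity (x ∷ p) (extend (∁ ⁅ 0F ⁆) Bs) ≡ multiplicity p Bs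
    by-slice with x ∈? ⁅ 0F ⁆
    ... | yes x∈0 = trans (cong₂ _+_ (multiplicity-in x∈0 p Bs)
                                     (multiplicity-out (x∈p⇒x∉∁p x∈0) p Bs))
                          (+-identityʳ _)
    ... | no  x∉0 = cong₂ _+_ (multiplicity-out x∉0 p Bs)
                              (multiplicity-in (x∉p⇒x∈∁p x∉0) p Bs)

  someDoubleCover : ∀ d → ∃ (HasDoubleCover d)
  someDoubleCover zero = 2 , [] ∷ [] ∷ [] , (VAll.[] ∷ VAll.[] ∷ [] , λ { [] → refl }) , refl
  someDoubleCover (suc d) with someDoubleCover d
  ... | _ , Bs , (proper , twice) , _ =
    _ , slices Bs
      , (slices-proper proper
        , λ { (x ∷ p) → trans (slices-multiplicity x p Bs) (twice p) })
      , refl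

abstract
  minimumSize : ∀ d → ∃ (IsMinimumSize d)
  minimumSize d = let m , cover = someDoubleCover d in least (hasDoubleCover? d) m cover

f : ℕ → ℕ
f d = proj₁ (minimumSize d)

g : ℕ → ℚ
g d = ℚ._/_ (+ f d) (2 ^ d) {{m^n≢0 2 d}}

ℕtoℚ : ℕ → ℚ
ℕtoℚ n = + n ℚ./ 1

T : ℚ → ℚ
T t = ½ ℚ.+ (+ 9 ℚ./ 16) ℚ.* t

-- e(d) → 0 as d → ∞.
IsLittleO1 : (ℕ → ℚ) → Set
IsLittleO1 e = ∀ ε → 0ℚ ℚ.< ε → ∃ λ N → ∀ d → N ≤ d → ∣ e d ∣ ℚ.< ε

module Submission where

-- Boxes multiply: if As covers the points of [3]^r with multiplicity m and Bs
-- those of [3]^s with multiplicity n, then As ⊗ Bs covers [3]^(r+s) with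
-- multiplicity m · n.  In [3]^4 there are eight boxes of size 2⁴ which cover 64
-- points exactly twice and miss the other 17, and these 17 points split into
-- nine boxes.  Multiplying the eight boxes by a partition of [3]^r into 2^r boxes
-- and the nine by a minimum double cover of [3]^r gives a double cover of
-- [3]^(r+4).  The error term 8/(6+d) satisfies e(d+4) ≥ 9/16 · e(d), so
-- g(d) ≤ 8/7 + e(d) passes from d to d+4, because T(8/7 + t) = 8/7 + 9/16 · t.

open import Defs
open import Data.Fin.Patterns using (0F; 1F; 2F)
open import Data.Fin.Properties using (all?)
open import Data.Fin.Subset using (Subset; ⁅_⁆; ∁)
open import Data.Fin.Subset.Properties using (_⊂?_; nonempty?)
open import Data.Integer.Base as ℤ using (+_)
import Data.Integer.Properties as ℤₚ
open import Data.List.Base as List using (List; []; _∷_; length; cartesianProductWith)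
open import Data.List.Properties using (filter-++; length-++; length-map; filter-accept; filter-reject)
open import Data.List.Relation.Unary.All as All using (All; []; _∷_)
import Data.List.Relation.Unary.All.Properties as Allₚ
open import Data.Nat.Base using (ℕ; zero; suc; _+_; _*_; _^_; _≤_; _<_; z≤n; NonZero)
import Data.Nat.Properties as ℕₚ
open import Data.Nat.Solver using (module +-*-Solver)
open import Data.Product.Base using (∃; _×_; _,_; proj₁; proj₂)
open import Data.Rational.Base as ℚ using (ℚ; mkℚ; _/_; toℚᵘ; ½; 0ℚ)
import Data.Rational.Properties as ℚₚ
open import Data.Rational.Unnormalised.Base as ℚᵘ using (mkℚᵘ; *≡*; *≤*; *<*) renaming (_/_ to _/ᵘ_)
import Data.Rational.Unnormalised.Properties as ℚᵘₚ
open import Data.Vec.Base as Vec using ([]; _∷_; _++_)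
open import Data.Vec.Relation.Binary.Pointwise.Inductive as Pointwise using ()
import Data.Vec.Relation.Unary.All as VAll
import Data.Vec.Relation.Unary.All.Properties as VAllₚ
open import Function.Base using (_∘_)
open import Level using (0ℓ)
open import Relation.Binary.PropositionalEquality
  using (_≡_; refl; sym; trans; cong; cong₂; subst; subst₂)
open import Relation.Nullary.Decidable using (Dec; yes; no; map′; _×-dec_; from-yes)
open import Relation.Nullary.Negation using (¬_)
open import Relation.Unary using (Decidable; Pred)

private
  variable
    d r s : ℕ

-- Upper bounds for `f` from covers, and decidable checks over all points.

-- `minimumSize` is abstract, so `f` is accessible only through its specification; this is the
-- minimality half, which turns an explicit cover into an upper bound.
f≤length : (Bs : List (Box d)) → DoubleCover Bs → f d ≤ length Bs
f≤length {d} Bs cover = proj₂ (proj₂ (minimumSize d)) (length Bs) (Bs , cover , refl)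

proper? : Decidable (Proper {d})
proper? = VAll.all? λ S → nonempty? S ×-dec (S ⊂? _)

-- For fixed `d` this reduces a claim about every point to evaluation under `from-yes`: 3 points for
-- `halves`, 81 for `outer+2core`, 243 for `cover₄₁`.
allPoints? : {P : Pred (Point d) 0ℓ} → Decidable P → Dec (∀ p → P p)
allPoints? {zero}  P? = map′ (λ P[] → λ { [] → P[] }) (λ P → P []) (P? [])
allPoints? {suc d} P? =
  map′ (λ P → λ { (x ∷ p) → P x p }) (λ P x p → P (x ∷ p))
       (all? λ x → allPoints? λ p → P? (x ∷ p))

-- Products of families of boxes.

infixr 7 _⊗_

_⊗_ : List (Box r) → List (Box s) → List (Box (r + s))
_⊗_ = cartesianProductWith _++_

length-⊗ : (As : List (Box r)) (Bs : List (Box s)) →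
           length (As ⊗ Bs) ≡ length As * length Bs
length-⊗ []       Bs = refl
length-⊗ (A ∷ As) Bs =
  trans (length-++ (List.map (A ++_) Bs)) (cong₂ _+_ (length-map (A ++_) Bs) (length-⊗ As Bs))

proper-⊗ : {As : List (Box r)} {Bs : List (Box s)} →
           All Proper As → All Proper Bs → All Proper (As ⊗ Bs)
proper-⊗ []       qs = []
proper-⊗ (p ∷ ps) qs =
  Allₚ.++⁺ (Allₚ.map⁺ (All.map (VAllₚ.++⁺ p) qs)) (proper-⊗ ps qs)

multiplicity-++ : (p : Point d) (As Bs : List (Box d)) →
                  multiplicity p (As List.++ Bs) ≡ multiplicity p As + multiplicity p Bs
multiplicity-++ p As Bs =
  trans (cong length (filter-++ (p ∈ᴮ?_) As Bs)) (length-++ (List.filter (p ∈ᴮ?_) As))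

multiplicity-∈ : {p : Point d} {B : Box d} → p ∈ᴮ B → ∀ Bs →
                 multiplicity p (B ∷ Bs) ≡ suc (multiplicity p Bs)
multiplicity-∈ {p = p} p∈B Bs = cong length (filter-accept (p ∈ᴮ?_) p∈B)

multiplicity-∉ : {p : Point d} {B : Box d} → ¬ p ∈ᴮ B → ∀ Bs →
                 multiplicity p (B ∷ Bs) ≡ multiplicity p Bs
multiplicity-∉ {p = p} p∉B Bs = cong length (filter-reject (p ∈ᴮ?_) p∉B)

multiplicity-map-∈ : {p : Point r} {A : Box r} → p ∈ᴮ A → (q : Point s) (Bs : List (Box s)) →
                     multiplicity (p ++ q) (List.map (A ++_) Bs) ≡ multiplicity q Bs
multiplicity-map-∈ p∈A q [] = refl
multiplicity-map-∈ {p = p} {A} p∈A q (B ∷ Bs) with q ∈ᴮ? B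
... | yes q∈B = trans (multiplicity-∈ (Pointwise.++⁺ p∈A q∈B) (List.map (A ++_) Bs))
                      (cong suc (multiplicity-map-∈ p∈A q Bs))
... | no  q∉B = trans (multiplicity-∉ (q∉B ∘ Pointwise.++ʳ⁻ p A) (List.map (A ++_) Bs))
                      (multiplicity-map-∈ p∈A q Bs)

multiplicity-map-∉ : {p : Point r} {A : Box r} → ¬ p ∈ᴮ A → (q : Point s) (Bs : List (Box s)) →
                     multiplicity (p ++ q) (List.map (A ++_) Bs) ≡ 0
multiplicity-map-∉ p∉A q [] = refl
multiplicity-map-∉ {p = p} {A} p∉A q (B ∷ Bs) =
  trans (multiplicity-∉ (p∉A ∘ Pointwise.++ˡ⁻ p A) (List.map (A ++_) Bs))
        (multiplicity-map-∉ p∉A q Bs)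

-- A point `p ++ q` lies in `A ++ B` exactly when `p` lies in `A` and `q` in `B`. So each `A`
-- containing `p` contributes one copy of the multiplicity of `q`, and every other `A` contributes
-- 0.
multiplicity-⊗ : (p : Point r) (q : Point s) (As : List (Box r)) (Bs : List (Box s)) →
                 multiplicity (p ++ q) (As ⊗ Bs) ≡ multiplicity p As * multiplicity q Bs
multiplicity-⊗ p q []       Bs = refl
multiplicity-⊗ p q (A ∷ As) Bs =
  trans (multiplicity-++ (p ++ q) (List.map (A ++_) Bs) (As ⊗ Bs)) by-head
  where
  by-head : multiplicity (p ++ q) (List.map (A ++_) Bs) + multiplicity (p ++ q) (As ⊗ Bs)
          ≡ multiplicity p (A ∷ As) * multiplicity q Bs
  by-head with p ∈ᴮ? A
  ... | yes p∈A = cong₂ _+_ (multiplicity-map-∈ p∈A q Bs) (multiplicity-⊗ p q As Bs)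
  ... | no  p∉A = cong₂ _+_ (multiplicity-map-∉ p∉A q Bs) (multiplicity-⊗ p q As Bs)

-- Sides, and partitions into boxes by bisecting each coordinate.

s₀ s₁ s₂ s₀₁ s₀₂ s₁₂ : Subset 3
s₀  = ⁅ 0F ⁆
s₁  = ⁅ 1F ⁆
s₂  = ⁅ 2F ⁆
s₀₁ = ∁ s₂
s₀₂ = ∁ s₁
s₁₂ = ∁ s₀

halves : List (Box 1)
halves = (s₀ ∷ []) ∷ (s₁₂ ∷ []) ∷ []

halves-proper : All Proper halves
halves-proper = from-yes (All.all? proper? halves)

halves-once : ∀ p → multiplicity p halves ≡ 1
halves-once = from-yes (allPoints? λ p → multiplicity p halves ℕₚ.≟ 1)

bisection : ∀ d → List (Box d)
bisection zero    = [] ∷ []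
bisection (suc d) = halves ⊗ bisection d

length-bisection : ∀ d → length (bisection d) ≡ 2 ^ d
length-bisection zero    = refl
length-bisection (suc d) =
  trans (length-⊗ halves (bisection d)) (cong (2 *_) (length-bisection d))

bisection-proper : ∀ d → All Proper (bisection d)
bisection-proper zero    = VAll.[] ∷ []
bisection-proper (suc d) = proper-⊗ halves-proper (bisection-proper d)

bisection-once : (p : Point d) → multiplicity p (bisection d) ≡ 1
bisection-once []      = refl
bisection-once {suc d} (x ∷ p) =
  trans (multiplicity-⊗ (x ∷ []) p halves (bisection d))
        (cong₂ _*_ (halves-once (x ∷ [])) (bisection-once p))

-- Taking every box of a partition twice gives a double cover. This crude bound serves the four base
-- cases of `g≤8/7+error`.
f≤2·2^ : ∀ d → f d ≤ 2 * 2 ^ d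
f≤2·2^ d = begin
  f d                                         ≤⟨ f≤length twofold (twofold-proper , twofold-twice) ⟩
  length twofold                              ≡⟨ length-++ (bisection d) ⟩
  length (bisection d) + length (bisection d) ≡⟨ cong (λ n → n + n) (length-bisection d) ⟩
  2 ^ d + 2 ^ d                               ≡⟨ cong (λ n → 2 ^ d + n) (ℕₚ.+-identityʳ (2 ^ d)) ⟨
  2 * 2 ^ d                                   ∎
  where
  open ℕₚ.≤-Reasoning
  twofold : List (Box d)
  twofold = bisection d List.++ bisection d
  twofold-proper : All Proper twofold
  twofold-proper = Allₚ.++⁺ (bisection-proper d) (bisection-proper d)
  twofold-twice : ∀ p → multiplicity p twofold ≡ 2
  twofold-twice p = trans (multiplicity-++ p (bisection d) (bisection d))
                          (cong₂ _+_ (bisection-once p) (bisection-once p))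

-- Two families in dimension four and the recursion for `f`.

-- The box of points differing from the given one in every coordinate. All its sides have two
-- elements, so in dimension four it has 16 points, and eight such boxes account for 128 = 2 · 64
-- incidences.
avoiding : Point d → Box d
avoiding = Vec.map (∁ ∘ ⁅_⁆)

-- The families outer, core and cover₄₁ were found by computer search.
outer : List (Box 4)
outer = List.map avoiding
  ( (2F ∷ 0F ∷ 1F ∷ 2F ∷ [])
  ∷ (0F ∷ 1F ∷ 2F ∷ 2F ∷ [])
  ∷ (1F ∷ 1F ∷ 1F ∷ 1F ∷ [])
  ∷ (1F ∷ 2F ∷ 0F ∷ 1F ∷ [])
  ∷ (1F ∷ 1F ∷ 2F ∷ 0F ∷ [])
  ∷ (0F ∷ 0F ∷ 0F ∷ 1F ∷ [])
  ∷ (2F ∷ 2F ∷ 2F ∷ 2F ∷ [])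
  ∷ (2F ∷ 0F ∷ 0F ∷ 0F ∷ [])
  ∷ [])

core : List (Box 4)
core =
    (s₀  ∷ s₂  ∷ s₁  ∷ s₀  ∷ [])
  ∷ (s₀₁ ∷ s₀  ∷ s₂  ∷ s₁  ∷ [])
  ∷ (s₁  ∷ s₀  ∷ s₂  ∷ s₀₂ ∷ [])
  ∷ (s₁  ∷ s₀  ∷ s₀₁ ∷ s₂  ∷ [])
  ∷ (s₁  ∷ s₁₂ ∷ s₀  ∷ s₂  ∷ [])
  ∷ (s₀₂ ∷ s₁  ∷ s₀  ∷ s₂  ∷ [])
  ∷ (s₂  ∷ s₁  ∷ s₀  ∷ s₀₁ ∷ [])
  ∷ (s₂  ∷ s₁  ∷ s₁₂ ∷ s₁  ∷ [])
  ∷ (s₂  ∷ s₀₂ ∷ s₂  ∷ s₁  ∷ [])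
  ∷ []

outer-proper : All Proper outer
outer-proper = from-yes (All.all? proper? outer)

core-proper : All Proper core
core-proper = from-yes (All.all? proper? core)

-- Over the naturals the equation leaves two cases: twice in `outer` and never in `core`, or never
-- in `outer` and once in `core`. The weights 1 and 2 are the multiplicities of the factors
-- multiplied in by `f-recursion`, namely `bisection r` and a minimum double cover.
outer+2core : ∀ q → multiplicity q outer + 2 * multiplicity q core ≡ 2
outer+2core = from-yes (allPoints? λ q → multiplicity q outer + 2 * multiplicity q core ℕₚ.≟ 2)

f-recursion : ∀ r → f (r + 4) ≤ 8 * 2 ^ r + 9 * f r
f-recursion r = begin
  f (r + 4)                                               ≤⟨ f≤length cover (cover-proper , cover-twice) ⟩
  length cover                                            ≡⟨ length-++ (bisection r ⊗ outer) ⟩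
  length (bisection r ⊗ outer) + length (Bs ⊗ core)       ≡⟨ cong₂ _+_ (length-⊗ (bisection r) outer) (length-⊗ Bs core) ⟩
  length (bisection r) * 8 + length Bs * 9                ≡⟨ cong₂ _+_ (cong (_* 8) (length-bisection r)) (cong (_* 9) length-Bs) ⟩
  2 ^ r * 8 + f r * 9                                     ≡⟨ cong₂ _+_ (ℕₚ.*-comm (2 ^ r) 8) (ℕₚ.*-comm (f r) 9) ⟩
  8 * 2 ^ r + 9 * f r                                     ∎
  where
  open ℕₚ.≤-Reasoning
  minimal : HasDoubleCover r (f r)
  minimal = proj₁ (proj₂ (minimumSize r))
  Bs = proj₁ minimal
  Bs-proper = proj₁ (proj₁ (proj₂ minimal))
  Bs-twice = proj₂ (proj₁ (proj₂ minimal))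
  length-Bs = proj₂ (proj₂ minimal)
  cover : List (Box (r + 4))
  cover = bisection r ⊗ outer List.++ Bs ⊗ core
  cover-proper : All Proper cover
  cover-proper = Allₚ.++⁺ (proper-⊗ (bisection-proper r) outer-proper) (proper-⊗ Bs-proper core-proper)
  cover-twice : ∀ p → multiplicity p cover ≡ 2
  cover-twice pq with Vec.splitAt r pq
  ... | p , q , refl = begin-equality
    multiplicity (p ++ q) cover
      ≡⟨ multiplicity-++ (p ++ q) (bisection r ⊗ outer) (Bs ⊗ core) ⟩
    multiplicity (p ++ q) (bisection r ⊗ outer) + multiplicity (p ++ q) (Bs ⊗ core)
      ≡⟨ cong₂ _+_ (multiplicity-⊗ p q (bisection r) outer) (multiplicity-⊗ p q Bs core) ⟩
    multiplicity p (bisection r) * multiplicity q outer + multiplicity p Bs * multiplicity q core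
      ≡⟨ cong₂ (λ m n → m * multiplicity q outer + n * multiplicity q core) (bisection-once p) (Bs-twice p) ⟩
    1 * multiplicity q outer + 2 * multiplicity q core
      ≡⟨ cong (λ n → n + 2 * multiplicity q core) (ℕₚ.*-identityˡ (multiplicity q outer)) ⟩
    multiplicity q outer + 2 * multiplicity q core
      ≡⟨ outer+2core q ⟩
    2 ∎

-- A double cover in dimension five and the bound for `f 9`.

cover₄₁ : List (Box 5)
cover₄₁ =
    (s₀  ∷ s₀  ∷ s₀₁ ∷ s₀  ∷ s₀  ∷ [])
  ∷ (s₀  ∷ s₀  ∷ s₀₂ ∷ s₀  ∷ s₀  ∷ [])
  ∷ (s₀  ∷ s₀  ∷ s₁₂ ∷ s₀  ∷ s₀  ∷ [])
  ∷ (s₀  ∷ s₀₁ ∷ s₂  ∷ s₀  ∷ s₁₂ ∷ [])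
  ∷ (s₀  ∷ s₀₁ ∷ s₀₁ ∷ s₁  ∷ s₁₂ ∷ [])
  ∷ (s₀  ∷ s₀₂ ∷ s₂  ∷ s₀  ∷ s₁₂ ∷ [])
  ∷ (s₀  ∷ s₀₂ ∷ s₀₁ ∷ s₀  ∷ s₁₂ ∷ [])
  ∷ (s₀  ∷ s₁₂ ∷ s₀  ∷ s₀  ∷ s₀₂ ∷ [])
  ∷ (s₀  ∷ s₁₂ ∷ s₂  ∷ s₀  ∷ s₀₁ ∷ [])
  ∷ (s₀  ∷ s₁₂ ∷ s₀₂ ∷ s₁₂ ∷ s₀₂ ∷ [])
  ∷ (s₀  ∷ s₁₂ ∷ s₁₂ ∷ s₀  ∷ s₀₂ ∷ [])
  ∷ (s₁  ∷ s₀₁ ∷ s₀₁ ∷ s₀₂ ∷ s₁₂ ∷ [])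
  ∷ (s₁  ∷ s₁₂ ∷ s₀₁ ∷ s₂  ∷ s₀₁ ∷ [])
  ∷ (s₁  ∷ s₁₂ ∷ s₀₁ ∷ s₀₁ ∷ s₀₁ ∷ [])
  ∷ (s₂  ∷ s₀₁ ∷ s₁₂ ∷ s₁₂ ∷ s₀₂ ∷ [])
  ∷ (s₂  ∷ s₀₂ ∷ s₀₂ ∷ s₁₂ ∷ s₁₂ ∷ [])
  ∷ (s₂  ∷ s₀₂ ∷ s₁₂ ∷ s₁₂ ∷ s₀₁ ∷ [])
  ∷ (s₀₁ ∷ s₀  ∷ s₀  ∷ s₁₂ ∷ s₀  ∷ [])
  ∷ (s₀₁ ∷ s₁  ∷ s₂  ∷ s₁₂ ∷ s₁  ∷ [])
  ∷ (s₀₁ ∷ s₂  ∷ s₁  ∷ s₁₂ ∷ s₂  ∷ [])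
  ∷ (s₀₁ ∷ s₀₁ ∷ s₁₂ ∷ s₁₂ ∷ s₀₂ ∷ [])
  ∷ (s₀₁ ∷ s₀₂ ∷ s₀₂ ∷ s₁₂ ∷ s₁₂ ∷ [])
  ∷ (s₀₁ ∷ s₀₂ ∷ s₁₂ ∷ s₁₂ ∷ s₀₁ ∷ [])
  ∷ (s₀₂ ∷ s₀  ∷ s₀  ∷ s₁₂ ∷ s₀  ∷ [])
  ∷ (s₀₂ ∷ s₁  ∷ s₂  ∷ s₁₂ ∷ s₁  ∷ [])
  ∷ (s₀₂ ∷ s₂  ∷ s₁  ∷ s₁₂ ∷ s₂  ∷ [])
  ∷ (s₀₂ ∷ s₀₁ ∷ s₀₁ ∷ s₀₂ ∷ s₁₂ ∷ [])
  ∷ (s₀₂ ∷ s₁₂ ∷ s₀₁ ∷ s₀  ∷ s₀₁ ∷ [])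
  ∷ (s₀₂ ∷ s₁₂ ∷ s₀₁ ∷ s₁₂ ∷ s₀₁ ∷ [])
  ∷ (s₁₂ ∷ s₀  ∷ s₀  ∷ s₀₁ ∷ s₀  ∷ [])
  ∷ (s₁₂ ∷ s₀  ∷ s₀  ∷ s₀₂ ∷ s₀  ∷ [])
  ∷ (s₁₂ ∷ s₁  ∷ s₂  ∷ s₀₁ ∷ s₁  ∷ [])
  ∷ (s₁₂ ∷ s₁  ∷ s₂  ∷ s₀₂ ∷ s₁  ∷ [])
  ∷ (s₁₂ ∷ s₂  ∷ s₁  ∷ s₀₁ ∷ s₂  ∷ [])
  ∷ (s₁₂ ∷ s₂  ∷ s₁  ∷ s₀₂ ∷ s₂  ∷ [])
  ∷ (s₁₂ ∷ s₀₁ ∷ s₀₁ ∷ s₁  ∷ s₁₂ ∷ [])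
  ∷ (s₁₂ ∷ s₀₁ ∷ s₁₂ ∷ s₀  ∷ s₀₂ ∷ [])
  ∷ (s₁₂ ∷ s₀₂ ∷ s₀₂ ∷ s₀  ∷ s₁₂ ∷ [])
  ∷ (s₁₂ ∷ s₀₂ ∷ s₁₂ ∷ s₀  ∷ s₀₁ ∷ [])
  ∷ (s₁₂ ∷ s₁₂ ∷ s₀₂ ∷ s₂  ∷ s₀₂ ∷ [])
  ∷ (s₁₂ ∷ s₁₂ ∷ s₀₂ ∷ s₀₁ ∷ s₀₂ ∷ [])
  ∷ []

cover₄₁-isDoubleCover : DoubleCover cover₄₁
cover₄₁-isDoubleCover =
    from-yes (All.all? proper? cover₄₁)
  , from-yes (allPoints? λ p → multiplicity p cover₄₁ ℕₚ.≟ 2)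

f9≤625 : f 9 ≤ 625
f9≤625 = ℕₚ.≤-trans (f-recursion 5)
  -- The recursion at r = 5: 8 · 2^5 = 256, and 256 + 9 · 41 = 625.
  (ℕₚ.+-monoʳ-≤ 256 (ℕₚ.*-monoʳ-≤ 9 (f≤length cover₄₁ cover₄₁-isDoubleCover)))

-- Order and arithmetic of fractions by cross-multiplication.

-- `_/_` on `ℚ` cancels common factors, which hides numerator and denominator. Unnormalised
-- fractions keep both, so comparisons, sums and products reduce there to identities and
-- inequalities between integers.
toℚᵘ-/ : ∀ i n .{{_ : NonZero n}} → toℚᵘ (i / n) ℚᵘ.≃ i /ᵘ n
toℚᵘ-/ i (suc n) = ℚₚ.toℚᵘ-fromℚᵘ (mkℚᵘ i n)

module _ (a b c d : ℕ) .{{_ : NonZero b}} .{{_ : NonZero d}} where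

  /-mono-≤ : a * d ≤ c * b → + a / b ℚ.≤ + c / d
  /-mono-≤ ad≤cb = ℚₚ.toℚᵘ-cancel-≤ (begin
    toℚᵘ (+ a / b) ≃⟨ toℚᵘ-/ (+ a) b ⟩
    + a /ᵘ b       ≤⟨ cross-≤ b d ad≤cb ⟩
    + c /ᵘ d       ≃⟨ toℚᵘ-/ (+ c) d ⟨
    toℚᵘ (+ c / d) ∎)
    where
    open ℚᵘₚ.≤-Reasoning
    -- The denominators are quantified afresh so that they can be matched as successors; only then
    -- does `_/ᵘ_` reduce.
    cross-≤ : ∀ b d .{{_ : NonZero b}} .{{_ : NonZero d}} →
              a * d ≤ c * b → + a /ᵘ b ℚᵘ.≤ + c /ᵘ d
    cross-≤ (suc _) (suc _) le = *≤* (subst₂ ℤ._≤_ (ℤₚ.pos-* a _) (ℤₚ.pos-* c _) (ℤ.+≤+ le))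

  /-mono-< : a * d < c * b → + a / b ℚ.< + c / d
  /-mono-< ad<cb = ℚₚ.toℚᵘ-cancel-< (begin-strict
    toℚᵘ (+ a / b) ≃⟨ toℚᵘ-/ (+ a) b ⟩
    + a /ᵘ b       <⟨ cross-< b d ad<cb ⟩
    + c /ᵘ d       ≃⟨ toℚᵘ-/ (+ c) d ⟨
    toℚᵘ (+ c / d) ∎)
    where
    open ℚᵘₚ.≤-Reasoning
    cross-< : ∀ b d .{{_ : NonZero b}} .{{_ : NonZero d}} →
              a * d < c * b → + a /ᵘ b ℚᵘ.< + c /ᵘ d
    cross-< (suc _) (suc _) lt = *<* (subst₂ ℤ._<_ (ℤₚ.pos-* a _) (ℤₚ.pos-* c _) (ℤ.+<+ lt))

  /-*-/ : .{{_ : NonZero (b * d)}} → (+ a / b) ℚ.* (+ c / d) ≡ + (a * c) / (b * d)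
  /-*-/ = ℚₚ.toℚᵘ-injective (begin-equality
    toℚᵘ ((+ a / b) ℚ.* (+ c / d))        ≃⟨ ℚₚ.toℚᵘ-homo-* (+ a / b) (+ c / d) ⟩
    toℚᵘ (+ a / b) ℚᵘ.* toℚᵘ (+ c / d)    ≃⟨ ℚᵘₚ.*-cong (toℚᵘ-/ (+ a) b) (toℚᵘ-/ (+ c) d) ⟩
    (+ a /ᵘ b) ℚᵘ.* (+ c /ᵘ d)            ≃⟨ product b d ⟩
    + (a * c) /ᵘ (b * d)                  ≃⟨ toℚᵘ-/ (+ (a * c)) (b * d) ⟨
    toℚᵘ (+ (a * c) / (b * d))            ∎)
    where
    open ℚᵘₚ.≤-Reasoning
    product : ∀ b d .{{_ : NonZero b}} .{{_ : NonZero d}} .{{_ : NonZero (b * d)}} →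
              (+ a /ᵘ b) ℚᵘ.* (+ c /ᵘ d) ℚᵘ.≃ + (a * c) /ᵘ (b * d)
    product (suc b) (suc d) = *≡* (cong (ℤ._* + (suc b * suc d)) (sym (ℤₚ.pos-* a c)))

  /-+-/ : .{{_ : NonZero (b * d)}} → (+ a / b) ℚ.+ (+ c / d) ≡ + (a * d + c * b) / (b * d)
  /-+-/ = ℚₚ.toℚᵘ-injective (begin-equality
    toℚᵘ ((+ a / b) ℚ.+ (+ c / d))        ≃⟨ ℚₚ.toℚᵘ-homo-+ (+ a / b) (+ c / d) ⟩
    toℚᵘ (+ a / b) ℚᵘ.+ toℚᵘ (+ c / d)    ≃⟨ ℚᵘₚ.+-cong (toℚᵘ-/ (+ a) b) (toℚᵘ-/ (+ c) d) ⟩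
    (+ a /ᵘ b) ℚᵘ.+ (+ c /ᵘ d)            ≃⟨ total b d ⟩
    + (a * d + c * b) /ᵘ (b * d)          ≃⟨ toℚᵘ-/ (+ (a * d + c * b)) (b * d) ⟨
    toℚᵘ (+ (a * d + c * b) / (b * d))    ∎)
    where
    open ℚᵘₚ.≤-Reasoning
    total : ∀ b d .{{_ : NonZero b}} .{{_ : NonZero d}} .{{_ : NonZero (b * d)}} →
            (+ a /ᵘ b) ℚᵘ.+ (+ c /ᵘ d) ℚᵘ.≃ + (a * d + c * b) /ᵘ (b * d)
    total (suc b) (suc d) = *≡* (cong (ℤ._* + (suc b * suc d))
      (cong₂ ℤ._+_ (sym (ℤₚ.pos-* a (suc d))) (sym (ℤₚ.pos-* c (suc b)))))

-- The normalised recursion.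

g-recursion : ∀ r → g (r + 4) ℚ.≤ T (g r)
g-recursion r = subst (g (r + 4) ℚ.≤_) (sym T-g)
  (/-mono-≤ (f (r + 4)) (2 ^ (r + 4)) (1 * (16 * 2 ^ r) + 9 * f r * 2) (2 * (16 * 2 ^ r)) (begin
  f (r + 4) * (2 * (16 * 2 ^ r))             ≤⟨ ℕₚ.*-monoˡ-≤ (2 * (16 * 2 ^ r)) (f-recursion r) ⟩
  (8 * 2 ^ r + 9 * f r) * (2 * (16 * 2 ^ r)) ≡⟨ regroup (2 ^ r) (f r) ⟩
  (1 * (16 * 2 ^ r) + 9 * f r * 2) * (2 ^ r * 2 ^ 4)
    ≡⟨ cong ((1 * (16 * 2 ^ r) + 9 * f r * 2) *_) (ℕₚ.^-distribˡ-+-* 2 r 4) ⟨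
  (1 * (16 * 2 ^ r) + 9 * f r * 2) * 2 ^ (r + 4) ∎))
  where
  open ℕₚ.≤-Reasoning
  instance
    2^r-nonZero : NonZero (2 ^ r)
    2^r-nonZero = ℕₚ.m^n≢0 2 r
    2^[r+4]-nonZero : NonZero (2 ^ (r + 4))
    2^[r+4]-nonZero = ℕₚ.m^n≢0 2 (r + 4)
    16·2^r-nonZero : NonZero (16 * 2 ^ r)
    16·2^r-nonZero = ℕₚ.m*n≢0 16 (2 ^ r)
    32·2^r-nonZero : NonZero (2 * (16 * 2 ^ r))
    32·2^r-nonZero = ℕₚ.m*n≢0 2 (16 * 2 ^ r)
  -- The right side is left unsimplified: it is the fraction that `/-*-/` followed by `/-+-/`
  -- produces, with ½ read as 1/2.
  T-g : T (g r) ≡ + (1 * (16 * 2 ^ r) + 9 * f r * 2) / (2 * (16 * 2 ^ r))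
  T-g = trans (cong (½ ℚ.+_) (/-*-/ 9 16 (f r) (2 ^ r)))
              (/-+-/ 1 2 (9 * f r) (16 * 2 ^ r))
  regroup : ∀ x y → (8 * x + 9 * y) * (2 * (16 * x)) ≡ (1 * (16 * x) + 9 * y * 2) * (x * 16)
  regroup = solve 2 (λ x y → (con 8 :* x :+ con 9 :* y) :* (con 2 :* (con 16 :* x))
                          := (con 1 :* (con 16 :* x) :+ con 9 :* y :* con 2) :* (x :* con 16)) refl
    where open +-*-Solver

-- The error term and the asymptotic bound.

-- A rational null sequence that shrinks by a factor of at least 9/16 over four steps. With shift k
-- this needs 9(k + 4 + d) ≤ 16(k + d), and k = 6 is the least integer that works at d = 0. The
-- numerator 8 is then the least integer giving 8/7 + `error d` ≥ 2 for all d ≤ 3.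
error : ℕ → ℚ
error d = + 8 / (6 + d)

error-littleO1 : IsLittleO1 error
error-littleO1 (mkℚ (+ zero) _ _) (ℚ.*<* (ℤ.+<+ ()))
-- Here ε = (n+1)/(m+1) ≥ 1/(m+1), so d ≥ 8(m+1) suffices: then 6 + d > 8(m+1).
error-littleO1 ε@(mkℚ (+ suc n) m _) _ = 8 * suc m , λ d 8m≤d →
  subst₂ ℚ._<_ (sym (ℚₚ.0≤p⇒∣p∣≡p (0≤error d))) (ℚₚ.↥p/↧p≡p ε) (/-mono-< 8 (6 + d) (suc n) (suc m) (begin-strict
    8 * suc m           ≤⟨ 8m≤d ⟩
    d                   <⟨ ℕₚ.m<n+m d (ℕₚ.0<1+n {5}) ⟩
    6 + d               ≤⟨ ℕₚ.m≤m+n (6 + d) (n * (6 + d)) ⟩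
    suc n * (6 + d)     ∎))
  where
  open ℕₚ.≤-Reasoning
  0≤error : ∀ d → 0ℚ ℚ.≤ error d
  0≤error d = /-mono-≤ 0 1 8 (6 + d) z≤n

9/16-error : ∀ d → (+ 9 / 16) ℚ.* error d ℚ.≤ error (4 + d)
9/16-error d = subst (ℚ._≤ error (4 + d)) (sym (/-*-/ 9 16 8 (6 + d)))
  (/-mono-≤ 72 (16 * (6 + d)) 8 (10 + d) (begin
    72 * (10 + d)                 ≤⟨ ℕₚ.m≤m+n (72 * (10 + d)) (48 + 56 * d) ⟩
    72 * (10 + d) + (48 + 56 * d) ≡⟨ solve 1 (λ x → con 72 :* (con 10 :+ x) :+ (con 48 :+ con 56 :* x)
                                                 := con 8 :* (con 16 :* (con 6 :+ x))) refl d ⟩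
    8 * (16 * (6 + d))            ∎))
  where
  open ℕₚ.≤-Reasoning
  open +-*-Solver

T-mono-≤ : ∀ {s t} → s ℚ.≤ t → T s ℚ.≤ T t
T-mono-≤ s≤t = ℚₚ.+-monoʳ-≤ ½ (ℚₚ.*-monoˡ-≤-nonNeg (+ 9 / 16) s≤t)

T-8/7+ : ∀ t → T ((+ 8 / 7) ℚ.+ t) ≡ (+ 8 / 7) ℚ.+ (+ 9 / 16) ℚ.* t
T-8/7+ t = trans (cong (½ ℚ.+_) (ℚₚ.*-distribˡ-+ (+ 9 / 16) (+ 8 / 7) t))
                 -- The constant ½ + 9/16 · 8/7 evaluates to 8/7, so reassociating already yields
                 -- the goal.
                 (sym (ℚₚ.+-assoc ½ ((+ 9 / 16) ℚ.* (+ 8 / 7)) ((+ 9 / 16) ℚ.* t)))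

g≤2 : ∀ d → g d ℚ.≤ + 2 / 1
g≤2 d = /-mono-≤ (f d) (2 ^ d) 2 1 {{ℕₚ.m^n≢0 2 d}}
  (subst (_≤ 2 * 2 ^ d) (sym (ℕₚ.*-identityʳ (f d))) (f≤2·2^ d))

-- Induction in steps of four. The base cases compare 2 with 8/7 + 8/(6+d); the tightest is d = 3,
-- where the sum is 128/63.
g≤8/7+error : ∀ d → g d ℚ.≤ (+ 8 / 7) ℚ.+ error d
g≤8/7+error 0 = ℚₚ.≤-trans (g≤2 0) (ℚₚ.≤ᵇ⇒≤ _)
g≤8/7+error 1 = ℚₚ.≤-trans (g≤2 1) (ℚₚ.≤ᵇ⇒≤ _)
g≤8/7+error 2 = ℚₚ.≤-trans (g≤2 2) (ℚₚ.≤ᵇ⇒≤ _)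
g≤8/7+error 3 = ℚₚ.≤-trans (g≤2 3) (ℚₚ.≤ᵇ⇒≤ _)
g≤8/7+error (suc (suc (suc (suc d)))) = begin
  g (4 + d)                                 ≡⟨ cong g (ℕₚ.+-comm 4 d) ⟩
  g (d + 4)                                 ≤⟨ g-recursion d ⟩
  T (g d)                                   ≤⟨ T-mono-≤ (g≤8/7+error d) ⟩
  T ((+ 8 / 7) ℚ.+ error d)                 ≡⟨ T-8/7+ (error d) ⟩
  (+ 8 / 7) ℚ.+ (+ 9 / 16) ℚ.* error d      ≤⟨ ℚₚ.+-monoʳ-≤ (+ 8 / 7) (9/16-error d) ⟩
  (+ 8 / 7) ℚ.+ error (4 + d)               ∎
  where open ℚₚ.≤-Reasoning

f≡g·2^ : ∀ d → ℕtoℚ (f d) ≡ g d ℚ.* ℕtoℚ (2 ^ d)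
-- Equality of the two fractions comes from antisymmetry, since `/-mono-≤` supplies the
-- cross-multiplication rule for the order.
f≡g·2^ d = trans (ℚₚ.≤-antisym
    (/-mono-≤ (f d) 1 (f d * 2 ^ d) (2 ^ d * 1) (ℕₚ.≤-reflexive cross))
    (/-mono-≤ (f d * 2 ^ d) (2 ^ d * 1) (f d) 1 (ℕₚ.≤-reflexive (sym cross))))
  (sym (/-*-/ (f d) (2 ^ d) (2 ^ d) 1))
  where
  instance
    2^d-nonZero : NonZero (2 ^ d)
    2^d-nonZero = ℕₚ.m^n≢0 2 d
    2^d*1-nonZero : NonZero (2 ^ d * 1)
    2^d*1-nonZero = ℕₚ.m*n≢0 (2 ^ d) 1
  cross : f d * (2 ^ d * 1) ≡ f d * 2 ^ d * 1
  cross = sym (ℕₚ.*-assoc (f d) (2 ^ d) 1)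

f≤[8/7+error]·2^ : ∀ d → ℕtoℚ (f d) ℚ.≤ ((+ 8 / 7) ℚ.+ error d) ℚ.* ℕtoℚ (2 ^ d)
f≤[8/7+error]·2^ d = subst (ℚ._≤ ((+ 8 / 7) ℚ.+ error d) ℚ.* ℕtoℚ (2 ^ d)) (sym (f≡g·2^ d))
  (ℚₚ.*-monoʳ-≤-nonNeg (ℕtoℚ (2 ^ d)) {{ℚₚ.normalize-nonNeg (2 ^ d) 1}} (g≤8/7+error d))

theorem7p3 : (∀ (r : ℕ) → f (r + 4) ≤ 8 * 2 ^ r + 9 * f r)
    × (∀ (r : ℕ) → g (r + 4) ℚ.≤ T (g r))
    × (T (+ 8 ℚ./ 7) ≡ (+ 8 ℚ./ 7))
    × (∃ λ (e : ℕ → ℚ) → IsLittleO1 e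
    × (∀ (d : ℕ) → ℕtoℚ (f d) ℚ.≤ ((+ 8 ℚ./ 7) ℚ.+ e d) ℚ.* ℕtoℚ (2 ^ d)))
    × (f 9 ≤ 625)
theorem7p3 = f-recursion , g-recursion , refl , (error , error-littleO1 , f≤[8/7+error]·2^) , f9≤625
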